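{- For every integer $t\geq 2$, if $G$ is an $n$-vertex triangle-free $K_{2,t}$-free graph with diameter $2$, and $G$ is not a star graph, then $G$ has minimum degree at least $(1+o(1))\frac{1}{(t-1)^2}\sqrt{n}$ and at most $(1+o(1))\sqrt{tn}$, and $G$ has maximum degree at least $\sqrt{n-1}$.
   Context: All graphs are finite, simple and undirected. A graph is $H$-free if it contains no (not necessarily induced) subgraph isomorphic to $H$; triangle-free means $K_3$-free. A graph has diameter $2$ if it is connected and the maximum distance between two of its vertices is exactly $2$. A star graph is a graph isomorphic to $K_{1,m}$ for some $m\geq 1$. The $o(1)$ terms are for fixed $t$ as $n\to\infty$, and are uniform over all graphs $G$ as in the claim: that is, for each fixed $t$ and each $\varepsilon>0$ there is $N$ such that every such $G$ with $n\geq N$ vertices has minimum degree at least $(1-\varepsilon)\frac{1}{(t-1)^2}\sqrt{n}$ and at most $(1+\varepsilon)\sqrt{tn}$. The maximum degree bound holds for all $n$. -}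

module Defs where

open import Data.Empty using (⊥)
open import Data.Fin.Base using (Fin)
open import Data.Fin.Properties using () renaming (_≟_ to _≟ᶠ_)
open import Data.Integer.Base using (+_; 1ℤ)
open import Data.List.Base using (List; map; filter; length; allFin)
open import Data.List.Extrema.Nat using (min; max)
open import Data.Nat.Base using (ℕ; zero; suc; _∸_; _^_; >-nonZero) renaming (_≤_ to _≤ⁿ_; _<_ to _<ⁿ_)
open import Data.Nat.Properties using (m^n≢0; m<n⇒0<n∸m)
open import Data.Product.Base using (_×_; Σ-syntax; ∃-syntax)
open import Data.Rational.Base using (ℚ; _/_; _*_; _≤_; ∣_∣)
open import Data.Sum.Base using (_⊎_; inj₁; inj₂)
open import Data.Unit.Base using (⊤; tt)
open import Function.Base using (_∘_)
open import Function.Bundles using (_↔_; _⇔_; Inverse)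
open import Function.Definitions using (Injective)
open import Level using (0ℓ)
open import Relation.Binary.Core using (Rel)
open import Relation.Binary.Definitions using (Decidable; Symmetric)
open import Relation.Binary.PropositionalEquality using (_≡_; _≢_; refl; sym; ≢-sym)
open import Relation.Nullary using (¬_; yes; no; ¬?)

record Graph (V : Set) : Set₁ where
  infix 4 _∼_ _∼?_
  field
    _∼_     : Rel V 0ℓ
    _∼?_    : Decidable _∼_
    ∼-sym   : Symmetric _∼_
    ∼-irrefl : ∀ {v} → ¬ (v ∼ v)

Complete : (n : ℕ) → Graph (Fin n)
Complete n = record
  { _∼_      = _≢_
  ; _∼?_     = λ i j → ¬? (i ≟ᶠ j)
  ; ∼-sym    = ≢-sym
  ; ∼-irrefl = λ v≢v → v≢v refl
  }

module _ {A B : Set} where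

  OppositeSides : Rel (A ⊎ B) 0ℓ
  OppositeSides (inj₁ _) (inj₁ _) = ⊥
  OppositeSides (inj₁ _) (inj₂ _) = ⊤
  OppositeSides (inj₂ _) (inj₁ _) = ⊤
  OppositeSides (inj₂ _) (inj₂ _) = ⊥

  oppositeSides? : Decidable OppositeSides
  oppositeSides? (inj₁ _) (inj₁ _) = no λ ()
  oppositeSides? (inj₁ _) (inj₂ _) = yes tt
  oppositeSides? (inj₂ _) (inj₁ _) = yes tt
  oppositeSides? (inj₂ _) (inj₂ _) = no λ ()

  oppositeSides-sym : Symmetric OppositeSides
  oppositeSides-sym {inj₁ _} {inj₂ _} _ = tt
  oppositeSides-sym {inj₂ _} {inj₁ _} _ = tt

  oppositeSides-irrefl : ∀ {v} → ¬ OppositeSides v v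
  oppositeSides-irrefl {inj₁ _} ()
  oppositeSides-irrefl {inj₂ _} ()

CompleteBipartite : (a b : ℕ) → Graph (Fin a ⊎ Fin b)
CompleteBipartite a b = record
  { _∼_      = OppositeSides
  ; _∼?_     = oppositeSides?
  ; ∼-sym    = λ {u} {v} → oppositeSides-sym {x = u} {v}
  ; ∼-irrefl = λ {v} → oppositeSides-irrefl {v = v}
  }

module _ {V W : Set} where

  -- Not necessarily induced: only adjacency has to be preserved.
  _ContainsSubgraph_ : Graph V → Graph W → Set
  G ContainsSubgraph H =
    ∃[ f ] Injective _≡_ _≡_ f × (∀ {x y} → x H.∼ y → f x G.∼ f y)
    where
    module G = Graph G
    module H = Graph H

  _-Free_ : Graph W → Graph V → Set
  H -Free G = ¬ (G ContainsSubgraph H)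

  _≅_ : Graph V → Graph W → Set
  G ≅ H = Σ[ φ ∈ V ↔ W ] (∀ u v → (u G.∼ v) ⇔ (Inverse.to φ u H.∼ Inverse.to φ v))
    where
    module G = Graph G
    module H = Graph H

module _ {V : Set} (G : Graph V) where
  open Graph G

  TriangleFree : Set
  TriangleFree = Complete 3 -Free G

  IsStar : Set
  IsStar = ∃[ m ] 1 ≤ⁿ m × G ≅ CompleteBipartite 1 m

  data Walk : V → V → ℕ → Set where
    []  : ∀ {v} → Walk v v zero
    _∷_ : ∀ {u v w k} → u ∼ v → Walk v w k → Walk u w (suc k)

  Connected : Set
  Connected = V × (∀ u v → ∃[ k ] Walk u v k)

  Distance : V → V → ℕ → Set
  Distance u v k = Walk u v k × (∀ {l} → l <ⁿ k → ¬ Walk u v l)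

  HasDiameter : ℕ → Set
  HasDiameter d =
    Connected ×
    (∀ u v k → Distance u v k → k ≤ⁿ d) ×
    (∃[ u ] ∃[ v ] Distance u v d)

module _ {n : ℕ} (G : Graph (Fin n)) where
  open Graph G

  degree : Fin n → ℕ
  degree v = length (filter (v ∼?_) (allFin n))

  degrees : List ℕ
  degrees = map degree (allFin n)

  -- The first argument of min and max is also taken into account.  As
  -- 0 ≤ degree v ≤ n for every vertex v, it only matters when n = 0.
  minDegree : ℕ
  minDegree = min n degrees

  maxDegree : ℕ
  maxDegree = max 0 degrees

fromℕ : ℕ → ℚ
fromℕ m = + m / 1

signedSquare : ℚ → ℚ
signedSquare q = q * ∣ q ∣

-- Comparison of a natural number d with the real number c√m.  Since
-- x ↦ x|x| is strictly increasing on the reals and maps c√m to c|c|m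
-- and d to d², these are exact for every rational c of either sign.

[_√_]≤_ : ℚ → ℕ → ℕ → Set
[ c √ m ]≤ d = signedSquare c * fromℕ m ≤ fromℕ d * fromℕ d

_≤[_√_] : ℕ → ℚ → ℕ → Set
d ≤[ c √ m ] = fromℕ d * fromℕ d ≤ signedSquare c * fromℕ m

infix 4 [_√_]≤_ _≤[_√_]

1/[_-1]² : (t : ℕ) → 2 ≤ⁿ t → ℚ
1/[ t -1]² 2≤t = 1ℤ / ((t ∸ 1) ^ 2)
  where instance _ = m^n≢0 (t ∸ 1) 2 {{>-nonZero (m<n⇒0<n∸m 2≤t)}}

{-# OPTIONS --safe #-}

-- Let A be the adjacency matrix and B = A + A². As G has diameter 2, is triangle-free and
-- K₂,ₜ-free, every off-diagonal entry of B lies between 1 and t − 1, while the diagonal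
-- entry at v is d(v). Hence the row sums d(v) + Σ_{u ∈ N(v)} d(u) of B lie between
-- d(v) + (n − 1) and d(v) + (t − 1)(n − 1), which gives Δ² ≥ n − 1 and δ² ≤ tn.
-- For nonadjacent u and v, comparing the (u, v) entries of AB = BA gives
-- d(u) ≤ (t − 1) d(v). Two such steps, through a common non-neighbour when
-- u and v are adjacent, give Δ ≤ (t − 1)² δ; without such a vertex G is complete bipartite
-- and the bound is immediate.
module Submission where

open import Data.Fin.Base using (Fin; zero; suc; inject≤; punchIn; punchOut)
open import Data.Product.Base using (_×_; _,_; ∃-syntax; proj₁; proj₂)
open import Data.Sum.Base using (_⊎_; inj₁; inj₂; [_,_]′)
open import Function.Base using (_∘_; id; const)
open import Level using (0ℓ)
open import Relation.Binary.PropositionalEquality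
open import Relation.Nullary using (¬_; Dec; yes; no; ¬?; contradiction; does; _×-dec_; _⊎-dec_; decidable-stable)
open import Defs

-- Rational comparisons with multiples of square roots.

module RootComparison where

  open import Data.Integer.Base as ℤ using (+_; 1ℤ; +≤+; +<+)
  import Data.Integer.Properties as ℤₚ
  open import Data.Nat.Base as ℕ using (ℕ; suc; _∸_; z≤n)
  import Data.Nat.Properties as ℕₚ
  open import Data.Rational.Base
  open import Data.Rational.Properties
  open import Data.Rational.Solver using (module +-*-Solver)
  import Data.Rational.Unnormalised.Base as ℚᵘ
  import Data.Rational.Unnormalised.Properties as ℚᵘₚ

  -- `_/_` divides out a gcd, which does not reduce for a variable numerator. Passing to
  -- unnormalised rationals leaves plain fractions with denominator 1; the homomorphism laws below
  -- take the same route.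
  fromℕ-mono : ∀ {m n} → m ℕ.≤ n → fromℕ m ≤ fromℕ n
  fromℕ-mono {m} {n} m≤n = toℚᵘ-cancel-≤ (begin
    toℚᵘ (fromℕ m)   ≃⟨ toℚᵘ-fromℚᵘ (ℚᵘ.mkℚᵘ (+ m) 0) ⟩
    ℚᵘ.mkℚᵘ (+ m) 0  ≤⟨ ℚᵘ.*≤* (ℤₚ.*-monoʳ-≤-nonNeg 1ℤ (+≤+ m≤n)) ⟩
    ℚᵘ.mkℚᵘ (+ n) 0  ≃⟨ toℚᵘ-fromℚᵘ (ℚᵘ.mkℚᵘ (+ n) 0) ⟨
    toℚᵘ (fromℕ n)   ∎)
    where open ℚᵘₚ.≤-Reasoning

  fromℕ-+ : ∀ m n → fromℕ (m ℕ.+ n) ≡ fromℕ m + fromℕ n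
  fromℕ-+ m n = toℚᵘ-injective (begin
    toℚᵘ (fromℕ (m ℕ.+ n))                ≈⟨ toℚᵘ-fromℚᵘ (ℚᵘ.mkℚᵘ (+ (m ℕ.+ n)) 0) ⟩
    ℚᵘ.mkℚᵘ (+ (m ℕ.+ n)) 0               ≈⟨ ℚᵘ.*≡* (cong (ℤ._* 1ℤ) (cong₂ ℤ._+_ (ℤₚ.*-identityʳ (+ m)) (ℤₚ.*-identityʳ (+ n)))) ⟨
    ℚᵘ.mkℚᵘ (+ m) 0 ℚᵘ.+ ℚᵘ.mkℚᵘ (+ n) 0  ≈⟨ ℚᵘₚ.+-cong (toℚᵘ-fromℚᵘ (ℚᵘ.mkℚᵘ (+ m) 0)) (toℚᵘ-fromℚᵘ (ℚᵘ.mkℚᵘ (+ n) 0)) ⟨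
    toℚᵘ (fromℕ m) ℚᵘ.+ toℚᵘ (fromℕ n)    ≈⟨ toℚᵘ-homo-+ (fromℕ m) (fromℕ n) ⟨
    toℚᵘ (fromℕ m + fromℕ n)              ∎)
    where open ℚᵘₚ.≃-Reasoning

  fromℕ-* : ∀ m n → fromℕ (m ℕ.* n) ≡ fromℕ m * fromℕ n
  fromℕ-* m n = toℚᵘ-injective (begin
    toℚᵘ (fromℕ (m ℕ.* n))                ≈⟨ toℚᵘ-fromℚᵘ (ℚᵘ.mkℚᵘ (+ (m ℕ.* n)) 0) ⟩
    ℚᵘ.mkℚᵘ (+ (m ℕ.* n)) 0               ≈⟨ ℚᵘ.*≡* (cong (ℤ._* 1ℤ) (ℤₚ.pos-* m n)) ⟩
    ℚᵘ.mkℚᵘ (+ m) 0 ℚᵘ.* ℚᵘ.mkℚᵘ (+ n) 0  ≈⟨ ℚᵘₚ.*-cong (toℚᵘ-fromℚᵘ (ℚᵘ.mkℚᵘ (+ m) 0)) (toℚᵘ-fromℚᵘ (ℚᵘ.mkℚᵘ (+ n) 0)) ⟨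
    toℚᵘ (fromℕ m) ℚᵘ.* toℚᵘ (fromℕ n)    ≈⟨ toℚᵘ-homo-* (fromℕ m) (fromℕ n) ⟨
    toℚᵘ (fromℕ m * fromℕ n)              ∎)
    where open ℚᵘₚ.≃-Reasoning

  0≤fromℕ : ∀ n → 0ℚ ≤ fromℕ n
  0≤fromℕ n = fromℕ-mono {0} {n} z≤n

  1/n*n≡1 : ∀ n .{{_ : ℕ.NonZero n}} → (1ℤ / n) * fromℕ n ≡ 1ℚ
  1/n*n≡1 n@(suc n-1) = toℚᵘ-injective (begin
    toℚᵘ ((1ℤ / n) * fromℕ n)            ≈⟨ toℚᵘ-homo-* (1ℤ / n) (fromℕ n) ⟩
    toℚᵘ (1ℤ / n) ℚᵘ.* toℚᵘ (fromℕ n)    ≈⟨ ℚᵘₚ.*-cong (toℚᵘ-fromℚᵘ (ℚᵘ.mkℚᵘ 1ℤ n-1)) (toℚᵘ-fromℚᵘ (ℚᵘ.mkℚᵘ (+ n) 0)) ⟩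
    ℚᵘ.mkℚᵘ 1ℤ n-1 ℚᵘ.* ℚᵘ.mkℚᵘ (+ n) 0  ≈⟨ ℚᵘ.*≡* (trans (ℤₚ.*-identityʳ _) (sym (trans (ℤₚ.*-identityˡ _) (trans (cong +_ (ℕₚ.*-identityʳ n)) (sym (ℤₚ.*-identityˡ (+ n))))))) ⟩
    ℚᵘ.1ℚᵘ                               ∎)
    where open ℚᵘₚ.≃-Reasoning

  *-nonNeg : ∀ {p q} → 0ℚ ≤ p → 0ℚ ≤ q → 0ℚ ≤ p * q
  *-nonNeg {p} {q} 0≤p 0≤q =
    nonNegative⁻¹ (p * q) {{nonNeg*nonNeg⇒nonNeg p {{nonNegative 0≤p}} q {{nonNegative 0≤q}}}}

  *-mono-≤-nonNeg : ∀ {p q r s} → 0ℚ ≤ r → 0ℚ ≤ q → p ≤ q → r ≤ s → p * r ≤ q * s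
  *-mono-≤-nonNeg {p} {q} {r} {s} 0≤r 0≤q p≤q r≤s = ≤-trans
    (*-monoʳ-≤-nonNeg r {{nonNegative 0≤r}} p≤q)
    (*-monoˡ-≤-nonNeg q {{nonNegative 0≤q}} r≤s)

  -- A positive `ε` has numerator at least 1, so it is at least the reciprocal of its denominator.
  -- This makes the denominator a threshold beyond which `ε * n` absorbs the 1 lost in `n ∸ 1`.
  1≤ε*n : ∀ {ε n} → 0ℚ < ε → ↧ₙ ε ℕ.≤ n → 1ℚ ≤ ε * fromℕ n
  1≤ε*n {ε@(mkℚ (+ suc k) d-1 _)} {n} _ d≤n = toℚᵘ-cancel-≤ (begin
    ℚᵘ.1ℚᵘ                       ≤⟨ ℚᵘ.*≤* (subst₂ ℤ._≤_ lhs rhs (+≤+ (ℕₚ.≤-trans d≤n (ℕₚ.m≤n*m n (suc k))))) ⟩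
    toℚᵘ ε ℚᵘ.* ℚᵘ.mkℚᵘ (+ n) 0  ≃⟨ ℚᵘₚ.*-congˡ {toℚᵘ ε} (toℚᵘ-fromℚᵘ (ℚᵘ.mkℚᵘ (+ n) 0)) ⟨
    toℚᵘ ε ℚᵘ.* toℚᵘ (fromℕ n)   ≃⟨ toℚᵘ-homo-* ε (fromℕ n) ⟨
    toℚᵘ (ε * fromℕ n)           ∎)
    where
    open ℚᵘₚ.≤-Reasoning
    lhs : + suc d-1 ≡ 1ℤ ℤ.* + (suc d-1 ℕ.* 1)
    lhs = trans (cong +_ (sym (ℕₚ.*-identityʳ (suc d-1)))) (sym (ℤₚ.*-identityˡ _))

    rhs : + (suc k ℕ.* n) ≡ (+ suc k ℤ.* + n) ℤ.* 1ℤ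
    rhs = trans (ℤₚ.pos-* (suc k) n) (sym (ℤₚ.*-identityʳ _))
  1≤ε*n {mkℚ (+ 0) _ _} (*<* (+<+ ()))
  1≤ε*n {mkℚ ℤ.-[1+ _ ] _ _} (*<* ())

  signedSquare-nonNeg : ∀ {c} → 0ℚ ≤ c → signedSquare c ≡ c * c
  signedSquare-nonNeg {c} 0≤c = cong (c *_) (0≤p⇒∣p∣≡p 0≤c)

  signedSquare-nonPos : ∀ {c} → c ≤ 0ℚ → signedSquare c ≤ 0ℚ
  signedSquare-nonPos {c} c≤0 = subst (signedSquare c ≤_) (*-zeroˡ ∣ c ∣)
    (*-monoʳ-≤-nonNeg ∣ c ∣ {{nonNegative (0≤∣p∣ c)}} c≤0)

  -- Here `q` is the reciprocal of `r`. If `ε` is at least 1, the coefficient is nonpositive and so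
  -- is its signed square. Otherwise one factor `1ℚ - ε` is bounded by 1, and the other turns `n`
  -- into at most `n - 1`, because `ε * n` is at least 1; the factors `q` and `r` then cancel.
  √-lower : ∀ {ε q} {n r d : ℕ} → 0ℚ < ε → ↧ₙ ε ℕ.≤ n → 0ℚ ≤ q → q * fromℕ r ≡ 1ℚ →
    n ∸ 1 ℕ.≤ (r ℕ.* d) ℕ.* (r ℕ.* d) → [ (1ℚ - ε) * q √ n ]≤ d
  √-lower {ε} {q} {n} {r} {d} 0<ε den≤n 0≤q qr≡1 n∸1≤ with ≤-total (1ℚ - ε) 0ℚ
  ... | inj₁ 1-ε≤0 = begin
    signedSquare c * fromℕ n  ≤⟨ *-monoʳ-≤-nonNeg (fromℕ n) {{nonNegative (0≤fromℕ n)}} (signedSquare-nonPos c≤0) ⟩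
    0ℚ * fromℕ n              ≡⟨ *-zeroˡ (fromℕ n) ⟩
    0ℚ                        ≤⟨ *-nonNeg (0≤fromℕ d) (0≤fromℕ d) ⟩
    fromℕ d * fromℕ d         ∎
    where
    open ≤-Reasoning
    c = (1ℚ - ε) * q
    c≤0 : c ≤ 0ℚ
    c≤0 = subst (c ≤_) (*-zeroˡ q) (*-monoʳ-≤-nonNeg q {{nonNegative 0≤q}} 1-ε≤0)
  ... | inj₂ 0≤1-ε = begin
    signedSquare (a * q) * N  ≡⟨ cong (_* N) (signedSquare-nonNeg (*-nonNeg 0≤1-ε 0≤q)) ⟩
    (a * q) * (a * q) * N     ≡⟨ solve 3 (λ a q N → (a :* q) :* (a :* q) :* N := a :* (a :* N) :* (q :* q)) refl a q N ⟩
    a * (a * N) * (q * q)     ≤⟨ *-monoʳ-≤-nonNeg (q * q) {{nonNegative (*-nonNeg 0≤q 0≤q)}}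
                                              (*-mono-≤-nonNeg (*-nonNeg 0≤1-ε (0≤fromℕ n)) (0≤fromℕ 1) a≤1 aN≤) ⟩
    1ℚ * ((R * D) * (R * D)) * (q * q)  ≡⟨ solve 4 (λ a q R D → a :* ((R :* D) :* (R :* D)) :* (q :* q) := (a :* (q :* R)) :* (q :* R) :* (D :* D)) refl 1ℚ q R D ⟩
    1ℚ * (q * R) * (q * R) * (D * D)    ≡⟨ cong (λ x → 1ℚ * x * x * (D * D)) qr≡1 ⟩
    1ℚ * 1ℚ * 1ℚ * (D * D)              ≡⟨ *-identityˡ (D * D) ⟩
    D * D                               ∎
    where
    open ≤-Reasoning
    open +-*-Solver
    a = 1ℚ - ε
    N = fromℕ n
    R = fromℕ r
    D = fromℕ d

    a≤1 : a ≤ 1ℚ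
    a≤1 = subst (a ≤_) (+-identityʳ 1ℚ) (+-monoʳ-≤ 1ℚ (neg-antimono-≤ (<⇒≤ 0<ε)))

    N≤ : N ≤ 1ℚ + (R * D) * (R * D)
    N≤ = begin
      N                                       ≤⟨ fromℕ-mono (ℕₚ.≤-trans (ℕₚ.m≤n+m∸n n 1) (ℕₚ.+-monoʳ-≤ 1 n∸1≤)) ⟩
      fromℕ (1 ℕ.+ (r ℕ.* d) ℕ.* (r ℕ.* d))   ≡⟨ fromℕ-+ 1 ((r ℕ.* d) ℕ.* (r ℕ.* d)) ⟩
      1ℚ + fromℕ ((r ℕ.* d) ℕ.* (r ℕ.* d))    ≡⟨ cong (λ x → 1ℚ + x) (fromℕ-* (r ℕ.* d) (r ℕ.* d)) ⟩
      1ℚ + fromℕ (r ℕ.* d) * fromℕ (r ℕ.* d)  ≡⟨ cong (λ x → 1ℚ + x * x) (fromℕ-* r d) ⟩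
      1ℚ + (R * D) * (R * D)                  ∎

    aN≤ : a * N ≤ (R * D) * (R * D)
    aN≤ = begin
      a * N                        ≡⟨ solve 2 (λ ε N → (con 1ℚ :+ :- ε) :* N := N :+ :- (ε :* N)) refl ε N ⟩
      N - ε * N                    ≤⟨ +-mono-≤ N≤ (neg-antimono-≤ (1≤ε*n 0<ε den≤n)) ⟩
      1ℚ + (R * D) * (R * D) - 1ℚ  ≡⟨ solve 1 (λ x → con 1ℚ :+ x :+ :- con 1ℚ := x) refl ((R * D) * (R * D)) ⟩
      (R * D) * (R * D)            ∎

  reciprocal-√-lower : ∀ {ε} {n s d : ℕ} .{{_ : ℕ.NonZero s}} → 0ℚ < ε → ↧ₙ ε ℕ.≤ n →
    n ∸ 1 ℕ.≤ (s ℕ.* d) ℕ.* (s ℕ.* d) → [ (1ℚ - ε) * (1ℤ / s) √ n ]≤ d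
  reciprocal-√-lower {s = s} {d} 0<ε den≤n =
    √-lower {r = s} {d} 0<ε den≤n (nonNegative⁻¹ _ {{normalize-nonNeg 1 s}}) (1/n*n≡1 s)

  1√-lower : ∀ {m d} → m ℕ.≤ d ℕ.* d → [ 1ℚ √ m ]≤ d
  1√-lower {m} {d} m≤d² = begin
    1ℚ * fromℕ m       ≡⟨ *-identityˡ (fromℕ m) ⟩
    fromℕ m            ≤⟨ fromℕ-mono m≤d² ⟩
    fromℕ (d ℕ.* d)    ≡⟨ fromℕ-* d d ⟩
    fromℕ d * fromℕ d  ∎
    where open ≤-Reasoning

  -- The hypothesis is the bound with coefficient 1, and squaring `1ℚ + ε` gives at least 1.
  √-upper : ∀ {ε} {m d : ℕ} → 0ℚ < ε → d ℕ.* d ℕ.≤ m → d ≤[ 1ℚ + ε √ m ]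
  √-upper {ε} {m} {d} 0<ε d²≤m = begin
    fromℕ d * fromℕ d         ≡⟨ fromℕ-* d d ⟨
    fromℕ (d ℕ.* d)           ≤⟨ fromℕ-mono d²≤m ⟩
    fromℕ m                   ≡⟨ *-identityˡ (fromℕ m) ⟨
    1ℚ * fromℕ m              ≤⟨ *-monoʳ-≤-nonNeg (fromℕ m) {{nonNegative (0≤fromℕ m)}} 1≤c² ⟩
    signedSquare c * fromℕ m  ∎
    where
    open ≤-Reasoning
    c = 1ℚ + ε
    1≤c : 1ℚ ≤ c
    1≤c = subst (_≤ c) (+-identityʳ 1ℚ) (+-monoʳ-≤ 1ℚ (<⇒≤ 0<ε))

    0≤c : 0ℚ ≤ c
    0≤c = ≤-trans (0≤fromℕ 1) 1≤c

    1≤c² : 1ℚ ≤ signedSquare c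
    1≤c² = begin
      1ℚ              ≤⟨ *-mono-≤-nonNeg (0≤fromℕ 1) 0≤c 1≤c 1≤c ⟩
      c * c           ≡⟨ signedSquare-nonNeg 0≤c ⟨
      signedSquare c  ∎

open import Data.Bool.Base using (if_then_else_; true; false)
open import Data.Fin.Patterns using (0F; 1F; 2F)
open import Data.Fin.Properties using (_≟_; any?; inject≤-injective; punchInᵢ≢i; punchIn-punchOut; punchOut-punchIn; punchOut-cong)
open import Data.List.Base using (List; filter; length; lookup; tabulate; allFin)
open import Data.List.Extrema.Nat using (min≤xs; xs≤max; max≤v⁺; argmin-all)
open import Data.List.Membership.Propositional.Properties using (∈-lookup; ∈-filter⁻)
open import Data.List.Properties using (length-filter; length-tabulate)
import Data.List.Relation.Unary.All as All
open import Data.List.Relation.Unary.All.Properties using (map⁺; map⁻; tabulate⁺; tabulate⁻)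
open import Data.List.Relation.Unary.Unique.Propositional using (Unique; _∷_)
open import Data.List.Relation.Unary.Unique.Propositional.Properties using (allFin⁺; filter⁺)
open import Data.Nat.Base using (ℕ; zero; suc; _+_; _*_; _∸_; _^_; _≤_; _<_; z≤n; s≤s; >-nonZero)
open import Data.Nat.Induction using (<-rec)
open import Data.Nat.Properties hiding (_≟_)
open import Data.Rational.Base using (ℚ; 0ℚ; 1ℚ; ↧ₙ_) renaming (_<_ to _<ℚ_; _+_ to _+ℚ_; _-_ to _-ℚ_; _*_ to _*ℚ_)
open import Data.Unit.Base using (tt)
open import Function.Bundles using (_⇔_; mk⇔; mk↔ₛ′)
open import Function.Definitions using (Injective)
open import Relation.Unary using (Pred; Decidable)
open import Algebra.Properties.Semiring.Sum +-*-semiring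

-- Finite sums, indicators and counting.

sum-mono : ∀ {n} {f g : Fin n → ℕ} → (∀ i → f i ≤ g i) → sum f ≤ sum g
sum-mono {zero}  f≤g = z≤n
sum-mono {suc n} f≤g = +-mono-≤ (f≤g zero) (sum-mono (f≤g ∘ suc))

sum-const : ∀ n c → sum {n} (const c) ≡ n * c
sum-const zero    c = refl
sum-const (suc n) c = cong (c +_) (sum-const n c)

term≤sum : ∀ {n} (f : Fin n → ℕ) i → f i ≤ sum f
term≤sum f zero    = m≤m+n _ _
term≤sum f (suc i) = ≤-trans (term≤sum (f ∘ suc) i) (m≤n+m _ _)

sum-offDiagonal-≥ : ∀ {n c} (f : Fin n → ℕ) i → (∀ j → i ≢ j → c ≤ f j) →
                    f i + (n ∸ 1) * c ≤ sum f
sum-offDiagonal-≥ {suc m} {c} f i c≤f = begin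
  f i + m * c                ≡⟨ cong (f i +_) (sum-const m c) ⟨
  f i + sum {m} (const c)    ≤⟨ +-monoʳ-≤ (f i) (sum-mono λ j → c≤f (punchIn i j) (≢-sym (punchInᵢ≢i i j))) ⟩
  f i + sum (f ∘ punchIn i)  ≡⟨ sum-remove f ⟨
  sum f                      ∎
  where open ≤-Reasoning

sum-offDiagonal-≤ : ∀ {n c} (f : Fin n → ℕ) i → (∀ j → i ≢ j → f j ≤ c) →
                    sum f ≤ f i + (n ∸ 1) * c
sum-offDiagonal-≤ {suc m} {c} f i f≤c = begin
  sum f                      ≡⟨ sum-remove f ⟩
  f i + sum (f ∘ punchIn i)  ≤⟨ +-monoʳ-≤ (f i) (sum-mono λ j → f≤c (punchIn i j) (≢-sym (punchInᵢ≢i i j))) ⟩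
  f i + sum {m} (const c)    ≡⟨ cong (f i +_) (sum-const m c) ⟩
  f i + m * c                ∎
  where open ≤-Reasoning

𝟙 : {P : Set} → Dec P → ℕ
𝟙 P? = if does P? then 1 else 0

𝟙-true : {P : Set} (P? : Dec P) → P → 𝟙 P? ≡ 1
𝟙-true (yes _) _ = refl
𝟙-true (no ¬p) p = contradiction p ¬p

𝟙-false : {P : Set} (P? : Dec P) → ¬ P → 𝟙 P? ≡ 0
𝟙-false (yes p) ¬p = contradiction p ¬p
𝟙-false (no _)  _  = refl

𝟙-×-dec : {P Q : Set} (P? : Dec P) (Q? : Dec Q) → 𝟙 (P? ×-dec Q?) ≡ 𝟙 P? * 𝟙 Q?
𝟙-×-dec (yes _) (yes _) = refl
𝟙-×-dec (yes _) (no _)  = refl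
𝟙-×-dec (no _)  _       = refl

𝟙-*-cong : {P : Set} (P? : Dec P) {x y : ℕ} → (P → x ≡ y) → 𝟙 P? * x ≡ 𝟙 P? * y
𝟙-*-cong (yes p) x≡y = cong (1 *_) (x≡y p)
𝟙-*-cong (no _)  _   = refl

𝟙-*-mono : {P : Set} (P? : Dec P) {x y : ℕ} → (P → x ≤ y) → 𝟙 P? * x ≤ 𝟙 P? * y
𝟙-*-mono (yes p) x≤y = *-monoʳ-≤ 1 (x≤y p)
𝟙-*-mono (no _)  _   = z≤n

module _ {A : Set} {P : Pred A 0ℓ} (P? : Decidable P) where

  length-filter-tabulate : ∀ {n} (f : Fin n → A) →
    length (filter P? (tabulate f)) ≡ sum (λ i → 𝟙 (P? (f i)))
  length-filter-tabulate {zero}  f = refl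
  length-filter-tabulate {suc n} f with does (P? (f zero))
  ... | true  = cong suc (length-filter-tabulate (f ∘ suc))
  ... | false = length-filter-tabulate (f ∘ suc)

lookup-injective : ∀ {A : Set} {xs : List A} → Unique xs → Injective _≡_ _≡_ (lookup xs)
lookup-injective (x≢ ∷ _)  {zero}  {zero}  _  = refl
lookup-injective (x≢ ∷ _)  {zero}  {suc j} eq = contradiction eq (All.lookup x≢ (∈-lookup j))
lookup-injective (x≢ ∷ _)  {suc i} {zero}  eq = contradiction (sym eq) (All.lookup x≢ (∈-lookup i))
lookup-injective (_ ∷ xs!) {suc i} {suc j} eq = cong suc (lookup-injective xs! eq)

module _ {n t : ℕ} {P : Pred (Fin n) 0ℓ} (P? : Decidable P) where

  -- Turns a count into an embedding: the filtered list has no repetitions, so its first `t`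
  -- positions hold distinct vertices. This supplies the large side of a `CompleteBipartite 2 t`.
  choose : t ≤ length (filter P? (allFin n)) →
           ∃[ f ] Injective {A = Fin t} _≡_ _≡_ f × (∀ i → P (f i))
  choose t≤ =
    (λ i → lookup chosen (inject≤ i t≤)) ,
    (λ eq → inject≤-injective t≤ t≤ _ _ (lookup-injective (filter⁺ P? (allFin⁺ n)) eq)) ,
    (λ i → proj₂ (∈-filter⁻ P? {xs = allFin n} (∈-lookup (inject≤ i t≤))))
    where chosen = filter P? (allFin n)

-- Local consequences of the forbidden subgraphs and of diameter 2.

module _ {n : ℕ} (G : Graph (Fin n)) where
  open Graph G

  ∼⇒≢ : ∀ {u v} → u ∼ v → u ≢ v
  ∼⇒≢ u∼v refl = ∼-irrefl u∼v

  triangleFree⇒noTriangle : TriangleFree G → ∀ {x y z} → x ∼ y → y ∼ z → ¬ x ∼ z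
  triangleFree⇒noTriangle free {x} {y} {z} x∼y y∼z x∼z = free (f , f-injective , f-mono)
    where
    f : Fin 3 → Fin n
    f 0F = x
    f 1F = y
    f 2F = z

    f-mono : ∀ {i j} → i ≢ j → f i ∼ f j
    f-mono {0F} {0F} i≢j = contradiction refl i≢j
    f-mono {0F} {1F} _   = x∼y
    f-mono {0F} {2F} _   = x∼z
    f-mono {1F} {0F} _   = ∼-sym x∼y
    f-mono {1F} {1F} i≢j = contradiction refl i≢j
    f-mono {1F} {2F} _   = y∼z
    f-mono {2F} {0F} _   = ∼-sym x∼z
    f-mono {2F} {1F} _   = ∼-sym y∼z
    f-mono {2F} {2F} i≢j = contradiction refl i≢j

    -- Distinct indices have adjacent images, and no vertex is adjacent to itself.
    f-injective : Injective _≡_ _≡_ f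
    f-injective {i} {j} eq = decidable-stable (i ≟ j) λ i≢j → ∼⇒≢ (f-mono i≢j) eq

  common? : ∀ u v → Decidable (λ x → u ∼ x × x ∼ v)
  common? u v x = (u ∼? x) ×-dec (x ∼? v)

  -- With `t` common neighbours, `u` and `v` would form the small side of a forbidden subgraph. The
  -- two sides cannot overlap, as adjacent vertices differ.
  free⇒codegree< : ∀ {t} → CompleteBipartite 2 t -Free G → ∀ {u v} → u ≢ v →
    length (filter (common? u v) (allFin n)) < t
  free⇒codegree< {t} free {u} {v} u≢v = ≰⇒> λ t≤ → contains (choose (common? u v) t≤)
    where
    contains : ¬ (∃[ f ] Injective {A = Fin t} _≡_ _≡_ f × (∀ i → u ∼ f i × f i ∼ v))
    contains (f , f-inj , common) = free (g , g-inj , λ {x} {y} → g-mono x y)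
      where
      g : Fin 2 ⊎ Fin t → Fin n
      g (inj₁ 0F) = u
      g (inj₁ 1F) = v
      g (inj₂ i)  = f i

      g-mono : ∀ x y → OppositeSides x y → g x ∼ g y
      g-mono (inj₁ 0F) (inj₂ j)  _ = proj₁ (common j)
      g-mono (inj₁ 1F) (inj₂ j)  _ = ∼-sym (proj₂ (common j))
      g-mono (inj₂ i)  (inj₁ 0F) _ = ∼-sym (proj₁ (common i))
      g-mono (inj₂ i)  (inj₁ 1F) _ = proj₂ (common i)

      g-inj : Injective _≡_ _≡_ g
      g-inj {inj₁ 0F} {inj₁ 0F} _  = refl
      g-inj {inj₁ 0F} {inj₁ 1F} eq = contradiction eq u≢v
      g-inj {inj₁ 1F} {inj₁ 0F} eq = contradiction (sym eq) u≢v
      g-inj {inj₁ 1F} {inj₁ 1F} _  = refl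
      g-inj {inj₁ i}  {inj₂ j}  eq = contradiction eq (∼⇒≢ (g-mono (inj₁ i) (inj₂ j) tt))
      g-inj {inj₂ i}  {inj₁ j}  eq = contradiction eq (∼⇒≢ (g-mono (inj₂ i) (inj₁ j) tt))
      g-inj {inj₂ i}  {inj₂ j}  eq = cong inj₂ (f-inj eq)

  -- The conclusion is decidable, so it may be proved by contradiction. Its failure rules out walks
  -- of length at most 2; then a shortest walk, which exists by connectedness, would have length
  -- above the diameter.
  diameter2⇒adjacentOrCommon : HasDiameter G 2 → ∀ {u v} → u ≢ v →
    u ∼ v ⊎ (∃[ x ] u ∼ x × x ∼ v)
  diameter2⇒adjacentOrCommon ((_ , connected) , dist≤2 , _) {u} {v} u≢v =
    decidable-stable ((u ∼? v) ⊎-dec any? (common? u v)) λ ¬close →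
      noWalk ¬close _ (proj₂ (connected u v))
    where
    module _ (¬close : ¬ (u ∼ v ⊎ (∃[ x ] u ∼ x × x ∼ v))) where

      noShortWalk : ∀ {k} → k ≤ 2 → ¬ Walk G u v k
      noShortWalk _ []                          = u≢v refl
      noShortWalk _ (u∼v ∷ [])                  = ¬close (inj₁ u∼v)
      noShortWalk _ (u∼x ∷ (x∼v ∷ []))          = ¬close (inj₂ (_ , u∼x , x∼v))
      noShortWalk (s≤s (s≤s ())) (_ ∷ (_ ∷ (_ ∷ _)))

      -- A walk with no shorter walk between its ends realises the distance.
      noWalk : ∀ k → ¬ Walk G u v k
      noWalk = <-rec _ λ k noShorter walk →
        noShortWalk (dist≤2 u v k (walk , noShorter)) walk

-- All other vertices are neighbours of `u`, so two adjacent ones would close a triangle. They are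
-- therefore independent and serve as the leaves, numbered by `punchIn u`.
dominating⇒star : ∀ {n} (G : Graph (Fin n)) → let open Graph G in
  TriangleFree G → ∀ {u v} → u ∼ v → (∀ w → u ≢ w → u ∼ w) → IsStar G
-- The edge excludes a single vertex, so there is at least one leaf.
dominating⇒star {suc zero}    G tf {zero} {zero} u∼v _ = contradiction u∼v (Graph.∼-irrefl G)
dominating⇒star {suc (suc m)} G tf {u} u∼v dominating =
  suc m , s≤s z≤n , mk↔ₛ′ to from to∘from from∘to , adjacency
  where
  open Graph G

  to : Fin (2 + m) → Fin 1 ⊎ Fin (suc m)
  to w with u ≟ w
  ... | yes _  = inj₁ zero
  ... | no u≢w = inj₂ (punchOut u≢w)

  from : Fin 1 ⊎ Fin (suc m) → Fin (2 + m)
  from (inj₁ _) = u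
  from (inj₂ i) = punchIn u i

  to∘from : ∀ x → to (from x) ≡ x
  to∘from (inj₁ zero) with u ≟ u
  ... | yes _  = refl
  ... | no u≢u = contradiction refl u≢u
  to∘from (inj₂ i) with u ≟ punchIn u i
  ... | yes eq = contradiction (sym eq) (punchInᵢ≢i u i)
  ... | no _   = cong inj₂ (trans (punchOut-cong u refl) (punchOut-punchIn u))

  from∘to : ∀ w → from (to w) ≡ w
  from∘to w with u ≟ w
  ... | yes eq = eq
  ... | no u≢w = punchIn-punchOut u≢w

  centre∼ : ∀ i → u ∼ punchIn u i
  centre∼ i = dominating _ (≢-sym (punchInᵢ≢i u i))

  -- Adjacency is compared on the side of the star, where the constructors decide it, and then
  -- carried back along `from∘to`.
  from-adjacency : ∀ x y → (from x ∼ from y) ⇔ OppositeSides x y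
  from-adjacency (inj₁ _) (inj₁ _) = mk⇔ ∼-irrefl λ ()
  from-adjacency (inj₁ _) (inj₂ j) = mk⇔ _ λ _ → centre∼ j
  from-adjacency (inj₂ i) (inj₁ _) = mk⇔ _ λ _ → ∼-sym (centre∼ i)
  from-adjacency (inj₂ i) (inj₂ j) =
    mk⇔ (λ i∼j → triangleFree⇒noTriangle G tf (centre∼ i) i∼j (centre∼ j)) λ ()

  adjacency : ∀ w z → (w ∼ z) ⇔ OppositeSides (to w) (to z)
  adjacency w z = subst₂ (λ w′ z′ → (w′ ∼ z′) ⇔ OppositeSides (to w) (to z))
    (from∘to w) (from∘to z) (from-adjacency (to w) (to z))

-- The adjacency matrix, its square, and extremal degrees.

module _ {n : ℕ} (G : Graph (Fin n)) where
  open Graph G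

  adj : Fin n → Fin n → ℕ
  adj u v = 𝟙 (u ∼? v)

  -- The entries of A².
  codegree : Fin n → Fin n → ℕ
  codegree u v = ∑[ x < n ] (adj u x * adj x v)

  -- The entries of B = A + A².
  shortPaths : Fin n → Fin n → ℕ
  shortPaths u v = adj u v + codegree u v

  adj-sym : ∀ u v → adj u v ≡ adj v u
  adj-sym u v with u ∼? v
  ... | yes u∼v = sym (𝟙-true (v ∼? u) (∼-sym u∼v))
  ... | no ¬u∼v = sym (𝟙-false (v ∼? u) (¬u∼v ∘ ∼-sym))

  adj-idem : ∀ u v → adj u v * adj u v ≡ adj u v
  adj-idem u v with u ∼? v
  ... | yes _ = refl
  ... | no _  = refl

  degree≡sum : ∀ v → degree G v ≡ ∑[ x < n ] adj v x
  degree≡sum v = length-filter-tabulate (v ∼?_) id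

  degree≤n : ∀ v → degree G v ≤ n
  degree≤n v = subst (degree G v ≤_) (length-tabulate id) (length-filter (v ∼?_) (allFin n))

  codegree≡length : ∀ u v → codegree u v ≡ length (filter (common? G u v) (allFin n))
  codegree≡length u v = trans
    (sum-cong-≗ λ x → sym (𝟙-×-dec (u ∼? x) (x ∼? v)))
    (sym (length-filter-tabulate (common? G u v) id))

  shortPaths-diagonal : ∀ v → shortPaths v v ≡ degree G v
  shortPaths-diagonal v = begin
    adj v v + codegree v v          ≡⟨ cong (_+ codegree v v) (𝟙-false (v ∼? v) ∼-irrefl) ⟩
    ∑[ x < n ] (adj v x * adj x v)  ≡⟨ sum-cong-≗ (λ x → trans (cong (adj v x *_) (adj-sym x v)) (adj-idem v x)) ⟩
    ∑[ x < n ] adj v x              ≡⟨ degree≡sum v ⟨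
    degree G v                      ∎
    where open ≡-Reasoning

  -- Walks of length 2 from `v` are counted by their middle vertex.
  sum-codegree : ∀ v → ∑[ w < n ] codegree v w ≡ ∑[ u < n ] (adj v u * degree G u)
  sum-codegree v = begin
    ∑[ w < n ] ∑[ u < n ] (adj v u * adj u w)  ≡⟨ ∑-comm (λ w u → adj v u * adj u w) ⟩
    ∑[ u < n ] ∑[ w < n ] (adj v u * adj u w)  ≡⟨ sum-cong-≗ (λ u → *-distribˡ-sum (adj v u) (adj u)) ⟨
    ∑[ u < n ] (adj v u * sum (adj u))         ≡⟨ sum-cong-≗ (λ u → cong (adj v u *_) (degree≡sum u)) ⟨
    ∑[ u < n ] (adj v u * degree G u)          ∎
    where open ≡-Reasoning

  sum-shortPaths : ∀ v →
    ∑[ w < n ] shortPaths v w ≡ degree G v + ∑[ u < n ] (adj v u * degree G u)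
  sum-shortPaths v = trans (∑-distrib-+ (adj v) (codegree v))
    (cong₂ _+_ (sym (degree≡sum v)) (sum-codegree v))

  -- This is AB = BA: B is a polynomial in A, and the only nontrivial part, A(A²) = (A²)A, is
  -- associativity, that is, an exchange of the two sums.
  adj-shortPaths-comm : ∀ u v →
    ∑[ x < n ] (adj u x * shortPaths x v) ≡ ∑[ y < n ] (shortPaths u y * adj y v)
  adj-shortPaths-comm u v = begin
    ∑[ x < n ] (adj u x * (adj x v + codegree x v))
      ≡⟨ sum-cong-≗ (λ x → *-distribˡ-+ (adj u x) (adj x v) (codegree x v)) ⟩
    ∑[ x < n ] (adj u x * adj x v + adj u x * codegree x v)
      ≡⟨ ∑-distrib-+ (λ x → adj u x * adj x v) (λ x → adj u x * codegree x v) ⟩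
    codegree u v + ∑[ x < n ] (adj u x * codegree x v)
      ≡⟨ cong (codegree u v +_) assoc ⟩
    codegree u v + ∑[ y < n ] (codegree u y * adj y v)
      ≡⟨ ∑-distrib-+ (λ y → adj u y * adj y v) (λ y → codegree u y * adj y v) ⟨
    ∑[ y < n ] (adj u y * adj y v + codegree u y * adj y v)
      ≡⟨ sum-cong-≗ (λ y → *-distribʳ-+ (adj y v) (adj u y) (codegree u y)) ⟨
    ∑[ y < n ] ((adj u y + codegree u y) * adj y v)
      ∎
    where
    open ≡-Reasoning
    assoc : ∑[ x < n ] (adj u x * codegree x v) ≡ ∑[ y < n ] (codegree u y * adj y v)
    assoc = begin
      ∑[ x < n ] (adj u x * codegree x v)
        ≡⟨ sum-cong-≗ (λ x → *-distribˡ-sum (adj u x) (λ y → adj x y * adj y v)) ⟩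
      ∑[ x < n ] ∑[ y < n ] (adj u x * (adj x y * adj y v))
        ≡⟨ ∑-comm (λ x y → adj u x * (adj x y * adj y v)) ⟩
      ∑[ y < n ] ∑[ x < n ] (adj u x * (adj x y * adj y v))
        ≡⟨ sum-cong-≗ (λ y → sum-cong-≗ λ x → *-assoc (adj u x) (adj x y) (adj y v)) ⟨
      ∑[ y < n ] ∑[ x < n ] (adj u x * adj x y * adj y v)
        ≡⟨ sum-cong-≗ (λ y → *-distribʳ-sum (adj y v) (λ x → adj u x * adj x y)) ⟨
      ∑[ y < n ] (codegree u y * adj y v)
        ∎

  degree≤maxDegree : ∀ v → degree G v ≤ maxDegree G
  degree≤maxDegree = tabulate⁻ (map⁻ {xs = allFin n} (xs≤max 0 (degrees G)))

  minDegree≤degree : ∀ v → minDegree G ≤ degree G v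
  minDegree≤degree = tabulate⁻ (map⁻ {xs = allFin n} (min≤xs n (degrees G)))

  maxDegree≤ : ∀ {d} → (∀ v → degree G v ≤ d) → maxDegree G ≤ d
  maxDegree≤ degree≤d = max≤v⁺ z≤n (map⁺ (tabulate⁺ degree≤d))

  -- The premise `P n` accounts for the default value `n` of `min`.
  minDegree-all : {P : ℕ → Set} → P n → (∀ v → P (degree G v)) → P (minDegree G)
  minDegree-all {P} Pn Pdegree = argmin-all id {P = P} Pn (map⁺ (tabulate⁺ Pdegree))

-- Degree bounds from the entries and row sums of B.

module DiameterTwo {n t : ℕ} (G : Graph (Fin n))
         (triangleFree : TriangleFree G) (K₂ₜ-free : CompleteBipartite 2 t -Free G)
         (diameter2 : HasDiameter G 2)
         where

  open Graph G

  private
    s = t ∸ 1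
    d = degree G

    noTriangle : ∀ {x y z} → x ∼ y → y ∼ z → ¬ x ∼ z
    noTriangle = triangleFree⇒noTriangle G triangleFree

  1≤shortPaths : ∀ {u v} → u ≢ v → 1 ≤ shortPaths G u v
  1≤shortPaths {u} {v} u≢v with diameter2⇒adjacentOrCommon G diameter2 u≢v
  ... | inj₁ u∼v = ≤-trans (≤-reflexive (sym (𝟙-true (u ∼? v) u∼v))) (m≤m+n _ _)
  ... | inj₂ (x , u∼x , x∼v) = begin
    1                      ≡⟨ cong₂ _*_ (𝟙-true (u ∼? x) u∼x) (𝟙-true (x ∼? v) x∼v) ⟨
    adj G u x * adj G x v  ≤⟨ term≤sum (λ x → adj G u x * adj G x v) x ⟩
    codegree G u v         ≤⟨ m≤n+m _ _ ⟩
    shortPaths G u v       ∎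
    where open ≤-Reasoning

  -- Row `v` of B has `n ∸ 1` off-diagonal entries, each at least 1. Its diagonal entry `d v` also
  -- occurs in the formula for the row sum and cancels.
  n∸1≤sum-neighbourDegrees : ∀ v → n ∸ 1 ≤ ∑[ u < n ] (adj G v u * d u)
  n∸1≤sum-neighbourDegrees v = +-cancelˡ-≤ (d v) _ _ (begin
    d v + (n ∸ 1)                       ≡⟨ cong₂ _+_ (shortPaths-diagonal G v) (*-identityʳ (n ∸ 1)) ⟨
    shortPaths G v v + (n ∸ 1) * 1      ≤⟨ sum-offDiagonal-≥ (shortPaths G v) v (λ _ → 1≤shortPaths) ⟩
    ∑[ w < n ] shortPaths G v w         ≡⟨ sum-shortPaths G v ⟩
    d v + ∑[ u < n ] (adj G v u * d u)  ∎)
    where open ≤-Reasoning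

  n∸1≤maxDegree² : n ∸ 1 ≤ maxDegree G * maxDegree G
  n∸1≤maxDegree² = begin
    n ∸ 1                         ≤⟨ n∸1≤sum-neighbourDegrees v ⟩
    ∑[ u < n ] (adj G v u * d u)  ≤⟨ sum-mono (λ u → *-monoʳ-≤ (adj G v u) (degree≤maxDegree G u)) ⟩
    ∑[ u < n ] (adj G v u * Δ)    ≡⟨ *-distribʳ-sum Δ (adj G v) ⟨
    sum (adj G v) * Δ             ≡⟨ cong (_* Δ) (degree≡sum G v) ⟨
    d v * Δ                       ≤⟨ *-monoˡ-≤ Δ (degree≤maxDegree G v) ⟩
    Δ * Δ                         ∎
    where
    open ≤-Reasoning
    Δ = maxDegree G
    -- Any vertex will do; `Connected` provides one.
    v = proj₁ (proj₁ diameter2)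

  module _ (2≤t : 2 ≤ t) where

    1≤s : 1 ≤ s
    1≤s = pred-mono-≤ 2≤t

    -- For adjacent vertices a common neighbour would close a triangle, so the entry is exactly 1,
    -- and 1 is at most `s` because `t` is at least 2. Otherwise the entry is a codegree, which is
    -- below `t`.
    shortPaths≤ : ∀ {u v} → u ≢ v → shortPaths G u v ≤ s
    shortPaths≤ {u} {v} u≢v with u ∼? v
    ... | no _ = subst (_≤ s) (sym (codegree≡length G u v)) (<⇒≤pred (free⇒codegree< G K₂ₜ-free u≢v))
    ... | yes u∼v = ≤-trans (≤-reflexive (cong suc codegree≡0)) 1≤s
      where
      codegree≡0 : codegree G u v ≡ 0
      codegree≡0 = trans (sum-cong-≗ λ x → trans (sym (𝟙-×-dec (u ∼? x) (x ∼? v)))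
        (𝟙-false (common? G u v x) λ (u∼x , x∼v) → noTriangle u∼x x∼v u∼v))
        (trans (sum-const n 0) (*-zeroʳ n))

    -- The (u, v) entry of AB sums entries of B over N(u), that of BA over N(v). Nonadjacency keeps
    -- both sums off the diagonal of B, so the first is at least `d u` and the second at most
    -- `s * d v`. The case of equal `u` and `v` is included.
    nonadjacent⇒degree≤ : ∀ {u v} → ¬ u ∼ v → d u ≤ s * d v
    nonadjacent⇒degree≤ {u} {v} u≁v = begin
      d u                                        ≡⟨ degree≡sum G u ⟩
      ∑[ x < n ] adj G u x                       ≡⟨ sum-cong-≗ (λ x → *-identityʳ (adj G u x)) ⟨
      ∑[ x < n ] (adj G u x * 1)                 ≤⟨ sum-mono (λ x → 𝟙-*-mono (u ∼? x) λ u∼x → 1≤shortPaths λ { refl → u≁v u∼x }) ⟩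
      ∑[ x < n ] (adj G u x * shortPaths G x v)  ≡⟨ adj-shortPaths-comm G u v ⟩
      ∑[ y < n ] (shortPaths G u y * adj G y v)  ≡⟨ sum-cong-≗ (λ y → trans (*-comm _ (adj G y v)) (cong (_* shortPaths G u y) (adj-sym G y v))) ⟩
      ∑[ y < n ] (adj G v y * shortPaths G u y)  ≤⟨ sum-mono (λ y → 𝟙-*-mono (v ∼? y) λ v∼y → shortPaths≤ λ { refl → u≁v (∼-sym v∼y) }) ⟩
      ∑[ y < n ] (adj G v y * s)                 ≡⟨ *-distribʳ-sum s (adj G v) ⟨
      sum (adj G v) * s                          ≡⟨ cong (_* s) (degree≡sum G v) ⟨
      d v * s                                    ≡⟨ *-comm (d v) s ⟩
      s * d v                                    ∎
      where open ≤-Reasoning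

    -- Such a graph is complete bipartite with parts N(u) and N(v). As it is not a star, v has a
    -- neighbour v′ other than u, and all of N(u) consists of common neighbours of u and v′.
    spanningEdge⇒degree≤ : ¬ IsStar G → ∀ {u v} → u ∼ v → (∀ w → u ∼ w ⊎ w ∼ v) → d u ≤ s
    spanningEdge⇒degree≤ ¬star {u} {v} u∼v covered
      with any? (λ x → (v ∼? x) ×-dec ¬? (u ≟ x))
    ... | no noOther = contradiction (dominating⇒star G triangleFree u∼v dominating) ¬star
      where
      dominating : ∀ w → u ≢ w → u ∼ w
      dominating w u≢w =
        -- A neighbour of `v` other than `u` has been excluded, so every `w` distinct from `u` is
        -- covered by `u`.
        [ id , (λ w∼v → contradiction (w , ∼-sym w∼v , u≢w) noOther) ]′ (covered w)
    ... | yes (v′ , v∼v′ , u≢v′) = begin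
      d u                         ≡⟨ degree≡sum G u ⟩
      ∑[ x < n ] adj G u x        ≡⟨ sum-cong-≗ (λ x → *-identityʳ (adj G u x)) ⟨
      ∑[ x < n ] (adj G u x * 1)  ≡⟨ sum-cong-≗ (λ x → 𝟙-*-cong (u ∼? x) λ u∼x → sym (𝟙-true (x ∼? v′) (N[u]∼v′ u∼x))) ⟩
      codegree G u v′             ≤⟨ m≤n+m _ _ ⟩
      shortPaths G u v′           ≤⟨ shortPaths≤ u≢v′ ⟩
      s                           ∎
      where
      open ≤-Reasoning
      u≁v′ : ¬ u ∼ v′
      u≁v′ = noTriangle u∼v v∼v′

      N[u]∼v′ : ∀ {x} → u ∼ x → x ∼ v′
      -- If `x` and `v′` were joined only through some `z`, then `z` would close a triangle with `u`
      -- and `x` or with `v` and `v′`, depending on which end of the edge covers it.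
      N[u]∼v′ {x} u∼x with diameter2⇒adjacentOrCommon G diameter2 {x} {v′} (λ { refl → u≁v′ u∼x })
      ... | inj₁ x∼v′ = x∼v′
      ... | inj₂ (z , x∼z , z∼v′) with covered z
      ...   | inj₁ u∼z = contradiction u∼z (noTriangle u∼x x∼z)
      ...   | inj₂ z∼v = contradiction z∼v′ (noTriangle z∼v v∼v′)

    -- Nonadjacent vertices cost one factor `s`, and a detour through a common non-neighbour costs
    -- two. When no such detour exists, the edge spans the graph and `d u` is at most `s`.
    degree≤ : ¬ IsStar G → ∀ u v → d u ≤ s * s * d v
    degree≤ ¬star u v with u ∼? v
    ... | no u≁v = begin
      d u          ≤⟨ nonadjacent⇒degree≤ u≁v ⟩
      s * d v      ≤⟨ *-monoˡ-≤ (d v) (m≤n*m s s {{>-nonZero 1≤s}}) ⟩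
      s * s * d v  ∎
      where open ≤-Reasoning
    ... | yes u∼v with any? (λ w → ¬? (u ∼? w) ×-dec ¬? (w ∼? v))
    ...   | yes (w , u≁w , w≁v) = begin
      d u            ≤⟨ nonadjacent⇒degree≤ u≁w ⟩
      s * d w        ≤⟨ *-monoʳ-≤ s (nonadjacent⇒degree≤ w≁v) ⟩
      s * (s * d v)  ≡⟨ *-assoc s s (d v) ⟨
      s * s * d v    ∎
      where open ≤-Reasoning
    ...   | no none = begin
      d u          ≤⟨ spanningEdge⇒degree≤ ¬star u∼v covered ⟩
      s            ≤⟨ m≤n*m s s {{>-nonZero 1≤s}} ⟩
      -- The edge makes `d v` positive, so the constant bound can be brought to the common form.
      s * s        ≤⟨ m≤m*n (s * s) (d v) {{>-nonZero 1≤degree}} ⟩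
      s * s * d v  ∎
      where
      open ≤-Reasoning
      covered : ∀ w → u ∼ w ⊎ w ∼ v
      covered w = decidable-stable ((u ∼? w) ⊎-dec (w ∼? v)) λ uncovered →
        none (w , uncovered ∘ inj₁ , uncovered ∘ inj₂)

      1≤degree : 1 ≤ d v
      1≤degree = begin
        1                     ≡⟨ 𝟙-true (v ∼? u) (∼-sym u∼v) ⟨
        adj G v u             ≤⟨ term≤sum (adj G v) u ⟩
        ∑[ x < n ] adj G v x  ≡⟨ degree≡sum G v ⟨
        d v                   ∎

    sum-neighbourDegrees≤ : ∀ v → ∑[ u < n ] (adj G v u * d u) ≤ (n ∸ 1) * s
    sum-neighbourDegrees≤ v = +-cancelˡ-≤ (d v) _ _ (begin
      d v + ∑[ u < n ] (adj G v u * d u)  ≡⟨ sum-shortPaths G v ⟨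
      ∑[ w < n ] shortPaths G v w         ≤⟨ sum-offDiagonal-≤ (shortPaths G v) v (λ _ → shortPaths≤) ⟩
      shortPaths G v v + (n ∸ 1) * s      ≡⟨ cong (_+ (n ∸ 1) * s) (shortPaths-diagonal G v) ⟩
      d v + (n ∸ 1) * s                   ∎)
      where open ≤-Reasoning

    -- The neighbour degrees of any `v` sum to at least `d v * δ`, hence to at least `δ * δ`, while
    -- the row sum of B caps them at `(n ∸ 1) * s`.
    minDegree²≤ : minDegree G * minDegree G ≤ t * n
    minDegree²≤ = begin
      δ * δ                         ≤⟨ *-monoˡ-≤ δ (minDegree≤degree G v) ⟩
      d v * δ                       ≡⟨ cong (_* δ) (degree≡sum G v) ⟩
      sum (adj G v) * δ             ≡⟨ *-distribʳ-sum δ (adj G v) ⟩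
      ∑[ u < n ] (adj G v u * δ)    ≤⟨ sum-mono (λ u → *-monoʳ-≤ (adj G v u) (minDegree≤degree G u)) ⟩
      ∑[ u < n ] (adj G v u * d u)  ≤⟨ sum-neighbourDegrees≤ v ⟩
      (n ∸ 1) * s                   ≤⟨ *-mono-≤ (m∸n≤m n 1) (m∸n≤m t 1) ⟩
      n * t                         ≡⟨ *-comm n t ⟩
      t * n                         ∎
      where
      open ≤-Reasoning
      δ = minDegree G
      v = proj₁ (proj₁ diameter2)

    n∸1≤[s²minDegree]² : ¬ IsStar G →
      n ∸ 1 ≤ (s * s * minDegree G) * (s * s * minDegree G)
    n∸1≤[s²minDegree]² ¬star = minDegree-all G
      -- The default value `n` is at least every degree, so its case follows by monotonicity from
      -- the bound at one vertex.
      {P = λ x → n ∸ 1 ≤ (s * s * x) * (s * s * x)} (grow (degree≤n G v) (bound v)) bound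
      where
      v = proj₁ (proj₁ diameter2)

      grow : ∀ {x y} → x ≤ y → n ∸ 1 ≤ (s * s * x) * (s * s * x) →
             n ∸ 1 ≤ (s * s * y) * (s * s * y)
      grow x≤y n∸1≤ = ≤-trans n∸1≤ (*-mono-≤ (*-monoʳ-≤ (s * s) x≤y) (*-monoʳ-≤ (s * s) x≤y))

      bound : ∀ v → n ∸ 1 ≤ (s * s * d v) * (s * s * d v)
      bound v = ≤-trans n∸1≤maxDegree² (*-mono-≤ Δ≤ Δ≤)
        where
        Δ≤ : maxDegree G ≤ s * s * d v
        Δ≤ = maxDegree≤ G (λ u → degree≤ ¬star u v)

proposition4 : ∀ (t : ℕ) (2≤t : 2 ≤ t) →
    (∀ (ε : ℚ) → 0ℚ <ℚ ε →
    ∃[ N ] (∀ (n : ℕ) (G : Graph (Fin n)) → N ≤ n →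
    TriangleFree G → CompleteBipartite 2 t -Free G →
    HasDiameter G 2 → ¬ IsStar G →
    ([ (1ℚ -ℚ ε) *ℚ 1/[ t -1]² 2≤t √ n ]≤ minDegree G) ×
    (minDegree G ≤[ 1ℚ +ℚ ε √ t * n ])))
    ×
    (∀ (n : ℕ) (G : Graph (Fin n)) →
    TriangleFree G → CompleteBipartite 2 t -Free G →
    HasDiameter G 2 → ¬ IsStar G →
    [ 1ℚ √ n ∸ 1 ]≤ maxDegree G)
proposition4 t 2≤t =
  -- The threshold is the denominator of `ε`, which ensures that `ε * n` is at least 1.
  (λ ε 0<ε → ↧ₙ ε , λ n G N≤n tf free diam ¬star →
    reciprocal-√-lower {s = (t ∸ 1) ^ 2} {minDegree G} {{m^n≢0 (t ∸ 1) 2 {{>-nonZero (m<n⇒0<n∸m 2≤t)}}}} 0<ε N≤n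
      (subst (λ r → n ∸ 1 ≤ (r * minDegree G) * (r * minDegree G))
        -- The power `(t ∸ 1) ^ 2` unfolds to a product ending in `* 1`.
        (cong ((t ∸ 1) *_) (sym (*-identityʳ (t ∸ 1))))
        (n∸1≤[s²minDegree]² G tf free diam 2≤t ¬star)) ,
    √-upper {d = minDegree G} 0<ε (minDegree²≤ G tf free diam 2≤t)) ,
  (λ n G tf free diam _ → 1√-lower {d = maxDegree G} (n∸1≤maxDegree² G tf free diam))
  where
  open RootComparison
  open DiameterTwo
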